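{- Let $x \geq 5$ be an integer with $x \equiv 1$ or $5 \pmod 6$. Then there exists a solution to $\mathrm{HWP}(6x;6,2x;1,3x-2)$.
   Context: For integers $M,N \geq 3$ and even $v$, a solution to $\mathrm{HWP}(v;M,N;\alpha,\beta)$ is a decomposition of the edge set of $K_v - F$, for some 1-factor (perfect matching) $F$ of $K_v$, into $\alpha$ $C_M$-factors and $\beta$ $C_N$-factors, where a $C_M$-factor is a spanning subgraph all of whose connected components are cycles of length $M$. -}

module Defs where

open import Data.Nat using (ℕ; zero; suc; _+_; _*_; _∸_; _%_; _≥_)
open import Data.Fin using (Fin; toℕ; fromℕ<)
open import Data.Fin.Properties using ()
open import Data.Nat.DivMod using (m%n<n)
open import Data.Product using (Σ; ∃; ∃-syntax; _×_; _,_)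
open import Data.Sum using (_⊎_)
open import Data.Unit using (⊤)
open import Relation.Binary.PropositionalEquality using (_≡_; _≢_)
open import Function using (Bijective)

-- Vertices of K_v are Fin v; edges are unordered pairs {a , b} with a ≢ b.

next : {M : ℕ} → Fin (suc M) → Fin (suc M)
next {M} i = fromℕ< (m%n<n (suc (toℕ i)) (suc M))

-- A C_M-factor of K_v (M = suc M′): k vertex-disjoint cycles of length M,
-- given as cyclic vertex sequences  F j : Fin M → Fin v  (j : Fin k),
-- such that (cycle index, position) ↦ vertex is a bijection onto Fin v
-- (so the cycles are simple, vertex-disjoint and span all vertices).
record CFactor (v M′ : ℕ) : Set where
  field
    k      : ℕ
    cyc    : Fin k → Fin (suc M′) → Fin v
    bij    : Bijective _≡_ _≡_ (λ (p : Fin k × Fin (suc M′)) → cyc (Data.Product.proj₁ p) (Data.Product.proj₂ p))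

EdgeIn : {v M′ : ℕ} → CFactor v M′ → Fin v → Fin v → Set
EdgeIn F a b =
  ∃[ j ] ∃[ i ] ((cyc j i ≡ a × cyc j (next i) ≡ b) ⊎ (cyc j i ≡ b × cyc j (next i) ≡ a))
  where open CFactor F

record OneFactor (v : ℕ) : Set where
  field
    mate     : Fin v → Fin v
    invol    : ∀ a → mate (mate a) ≡ a
    no-fix   : ∀ a → mate a ≢ a

EdgeInMatching : {v : ℕ} → OneFactor v → Fin v → Fin v → Set
EdgeInMatching F a b = OneFactor.mate F a ≡ b

ExactlyOne : {I : Set} → (I → Set) → Set
ExactlyOne {I} P = Σ I λ i → P i × (∀ j → P j → j ≡ i)

-- HWP(v; M, N; α, β) with M = suc M′, N = suc N′ (requires M, N ≥ 3):
-- a 1-factor F together with α C_M-factors and β C_N-factors such that every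
-- edge {a , b} of K_v lies in exactly one of F, the C_M-factors, the C_N-factors;
-- i.e. the factors decompose the edge set of K_v − F.
record HWP (v M′ N′ α β : ℕ) : Set where
  field
    matching : OneFactor v
    mfac     : Fin α → CFactor v M′
    nfac     : Fin β → CFactor v N′
    decomp   : ∀ (a b : Fin v) → a ≢ b →
      ExactlyOne {⊤ ⊎ (Fin α ⊎ Fin β)}
        (Data.Sum.[ (λ _ → EdgeInMatching matching a b)
                  , Data.Sum.[ (λ i → EdgeIn (mfac i) a b)
                             , (λ i → EdgeIn (nfac i) a b) ] ])

HWPSolution : (v M N α β : ℕ) → Set
HWPSolution v M N α β = HWP v (M ∸ 1) (N ∸ 1) α β

{-# OPTIONS --safe #-}

-- Write x = 2n + 1.  The vertices are Z₃ × {0,1} × Zₓ, and all families of factors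
-- are invariant under translation in Zₓ.  The prism on Z₃ × {0,1}, placed over every i ∈ Zₓ,
-- splits into the hexagon factor and the 1-factor.  A Walecki zigzag
--   0, 1, −1, 2, −2, …   (with ±k in row k mod 2)
-- uses each difference inside a row and each difference between the rows exactly once; moving
-- one of its edges to another class of Z₃-differences lets it close up to a 2x-cycle, whose
-- three Z₃-translates form a C₂ₓ-factor with x translates.  The remaining differences occur in
-- pairs d, d + 1, which yield 2x-cycles alternating between two of the six levels, grouped
-- along perfect matchings of the levels.
--
-- By counting it suffices to show that every factor meets every vertex and that every edge
-- lies in some factor.

module Submission where

open import Defs
open import Data.Bool using (Bool; true; false; not; _xor_)
import Data.Bool.Properties as Bool
open import Data.Nat as ℕ using (ℕ; zero; suc; _+_; _*_; _∸_; _≥_; _%_; _<_; _≤_; s≤s; z≤n)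
import Data.Nat.Properties as ℕ
open import Data.Nat.DivMod using (m<n⇒m%n≡m; n%n≡0; m≡m%n+[m/n]*n)
import Data.Nat.Tactic.RingSolver as ℕSolver
open import Data.Integer using (ℤ; +_; -[1+_]; -_; _-_; _%ℕ_; _/ℕ_) renaming (_+_ to _⊕_; _*_ to _⊗_)
import Data.Integer.Properties as ℤ
open import Data.Integer.DivMod using (n%ℕd<d; a≡a%ℕn+[a/ℕn]*n)
open import Data.Integer.Tactic.RingSolver using (solve-∀)
open import Data.Fin using (Fin; zero; suc; toℕ; fromℕ; fromℕ<; inject₁; punchOut; combine; remQuot; splitAt; _↑ˡ_; _↑ʳ_)
open import Data.Fin.Patterns using (0F; 1F; 2F; 3F; 4F; 5F)
open import Data.Fin.Properties
open import Data.Product using (∃; ∃-syntax; ∃₂; _×_; _,_; proj₁; proj₂)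
open import Data.Product.Function.NonDependent.Propositional using (_×-↔_)
open import Data.Sum using (_⊎_; inj₁; inj₂; [_,_])
open import Data.Sum.Function.Propositional using (_⊎-↔_)
open import Data.Unit using (⊤; tt)
open import Function using (_∘_; id; Injective; Inverse; _↔_)
open import Function.Consequences.Propositional using (strictlySurjective⇒surjective)
open import Function.Construct.Composition using (_↔-∘_)
open import Function.Construct.Identity using (↔-id)
open import Relation.Nullary using (¬_; yes; no; contradiction)
open import Relation.Binary.PropositionalEquality using (_≡_; _≢_; refl; sym; trans; cong; cong₂; subst; subst₂; ≢-sym; module ≡-Reasoning)

private variable
  A : Set
  m n v M′ N′ α β : ℕ

-- Finite sets: surjections between sets of equal size are injective.

injective⇒hits : {g : Fin n → Fin n} → Injective _≡_ _≡_ g → ∀ i → ¬ (∀ y → g y ≢ i)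
injective⇒hits {suc n} g-inj i miss = ℕ.1+n≰n (injective⇒≤ {f = λ y → punchOut (miss y ∘ sym)}
  λ {y} {y′} eq → g-inj (punchOut-injective (miss y ∘ sym) (miss y′ ∘ sym) eq))

-- A section of `f` is injective, so by the pigeonhole principle it hits every `k`; this makes it a
-- left inverse of `f` as well.
surjective⇒injective : {f : Fin n → Fin n} → (∀ y → ∃[ x ] f x ≡ y) → Injective _≡_ _≡_ f
surjective⇒injective {n} {f} surj {i} {j} fi≡fj with i ≟ j
... | yes i≡j = i≡j
... | no  i≢j = contradiction section-hits λ hit →
                  i≢j (trans (sym (hit i)) (trans (cong g fi≡fj) (hit j)))
  where
  g : Fin n → Fin n
  g = proj₁ ∘ surj
  g-inj : Injective _≡_ _≡_ g
  g-inj {y} {y′} eq = trans (sym (proj₂ (surj y))) (trans (cong f eq) (proj₂ (surj y′)))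
  section-hits : ∀ k → g (f k) ≡ k
  section-hits k with g (f k) ≟ k
  ... | yes eq  = eq
  ... | no  neq = contradiction
    (λ y gy≡k → neq (trans (cong (g ∘ f) (sym gy≡k)) (trans (cong g (proj₂ (surj y))) gy≡k)))
    (injective⇒hits g-inj k)

surjective⇒injective-↔ : Fin n ↔ A → {f : A → Fin n} → (∀ y → ∃[ x ] f x ≡ y) → Injective _≡_ _≡_ f
surjective⇒injective-↔ e {f} surj {a} {b} fa≡fb = begin
  a            ≡⟨ strictlyInverseˡ a ⟨
  to (from a)  ≡⟨ cong to (surjective⇒injective surj′ (trans (f-from a) (trans fa≡fb (sym (f-from b))))) ⟩
  to (from b)  ≡⟨ strictlyInverseˡ b ⟩
  b            ∎
  where
  open Inverse e
  open ≡-Reasoning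
  f-from : ∀ c → f (to (from c)) ≡ f c
  f-from c = cong f (strictlyInverseˡ c)
  surj′ : ∀ y → ∃[ i ] f (to i) ≡ y
  surj′ y = let c , eq = surj y in from c , trans (f-from c) eq

-- Cyclic order and cycle factors.

prev : Fin (suc m) → Fin (suc m)
prev zero    = fromℕ _
prev (suc i) = inject₁ i

toℕ-next : (i : Fin (suc m)) → toℕ (next i) ≡ suc (toℕ i) % suc m
toℕ-next i = toℕ-fromℕ< _

toℕ-next-< : (i : Fin (suc m)) → suc (toℕ i) < suc m → toℕ (next i) ≡ suc (toℕ i)
toℕ-next-< i lt = trans (toℕ-next i) (m<n⇒m%n≡m lt)

next-last : (i : Fin (suc m)) → toℕ i ≡ m → next i ≡ zero
next-last {m} i eq = toℕ-injective (trans (toℕ-next i) (trans (cong (λ k → suc k % suc m) eq) (n%n≡0 (suc m))))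

prev-next : (i : Fin (suc m)) → prev (next i) ≡ i
prev-next {m} i with toℕ i ℕ.≟ m
... | yes eq  = trans (cong prev (next-last i eq)) (toℕ-injective (trans (toℕ-fromℕ m) (sym eq)))
... | no  neq = toℕ-injective (ℕ.suc-injective
    (toℕ-prev (next i) (toℕ-next-< i (s≤s (ℕ.≤∧≢⇒< (toℕ≤pred[n] i) neq)))))
  where
  toℕ-prev : (j : Fin (suc m)) → toℕ j ≡ suc (toℕ i) → suc (toℕ (prev j)) ≡ suc (toℕ i)
  toℕ-prev (suc j) eq = trans (cong suc (toℕ-inject₁ j)) eq

-- There are as many positions as vertices, so visiting every vertex already gives the bijection.
cfactor : ∀ k → k * suc M′ ≡ v → (c : Fin k → Fin (suc M′) → Fin v) →
  (∀ a → ∃[ p ] c (proj₁ p) (proj₂ p) ≡ a) → CFactor v M′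
cfactor k eq c surj = record
  { k   = k
  ; cyc = c
  ; bij = surjective⇒injective-↔ (subst (λ m → Fin m ↔ _) eq *↔×) surj , strictlySurjective⇒surjective surj
  }

EdgeIn-sym : (F : CFactor v M′) {a b : Fin v} → EdgeIn F a b → EdgeIn F b a
EdgeIn-sym F (j , i , inj₁ e) = j , i , inj₂ e
EdgeIn-sym F (j , i , inj₂ e) = j , i , inj₁ e

module _ (F : CFactor v M′) where
  open CFactor F

  position : ∀ a → ∃[ p ] cyc (proj₁ p) (proj₂ p) ≡ a
  position a = let p , eq = proj₂ bij a in p , eq refl

  neighbour : Fin v → Fin 2 → Fin v
  neighbour a 0F = let (j , i) , _ = position a in cyc j (next i)
  neighbour a 1F = let (j , i) , _ = position a in cyc j (prev i)

  position-unique : ∀ {a j i} → cyc j i ≡ a → proj₁ (position a) ≡ (j , i)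
  position-unique {a} eq = proj₁ bij (trans (proj₂ (position a)) (sym eq))

  -- The factor passes through `a` at a single position, so an edge at `a` leads to the vertex just
  -- after or just before it.
  EdgeIn⇒neighbour : ∀ {a b} → EdgeIn F a b → ∃[ t ] neighbour a t ≡ b
  EdgeIn⇒neighbour {a} (j , i , inj₁ (at-a , at-b)) =
    0F , trans (cong (λ p → cyc (proj₁ p) (next (proj₂ p))) (position-unique at-a)) at-b
  EdgeIn⇒neighbour {a} (j , i , inj₂ (at-b , at-a)) =
    1F , trans (cong (λ p → cyc (proj₁ p) (prev (proj₂ p))) (position-unique at-a))
               (trans (cong (cyc j) (prev-next i)) at-b)

-- Counting the neighbours of a vertex.

module _ (matching : OneFactor v) (mfac : Fin α → CFactor v M′) (nfac : Fin β → CFactor v N′) where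

  InFactor : Fin v → Fin v → ⊤ ⊎ (Fin α ⊎ Fin β) → Set
  InFactor a b = [ (λ _ → EdgeInMatching matching a b)
                 , [ (λ i → EdgeIn (mfac i) a b) , (λ i → EdgeIn (nfac i) a b) ] ]

  -- The possible neighbours of a vertex a: a itself, its mate, and two for each cycle factor.
  Slot : Set
  Slot = Fin 1 ⊎ (Fin 1 ⊎ ((Fin α ⊎ Fin β) × Fin 2))

  slots : Fin (1 + (1 + (α + β) * 2)) ↔ Slot
  slots = (↔-id _ ⊎-↔ ((↔-id _ ⊎-↔ ((+↔⊎ ×-↔ ↔-id _) ↔-∘ *↔×)) ↔-∘ +↔⊎)) ↔-∘ +↔⊎

  atSlot : Fin v → Slot → Fin v
  atSlot a (inj₁ _)                     = a
  atSlot a (inj₂ (inj₁ _))              = OneFactor.mate matching a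
  atSlot a (inj₂ (inj₂ (inj₁ i , t)))   = neighbour (mfac i) a t
  atSlot a (inj₂ (inj₂ (inj₂ i , t)))   = neighbour (nfac i) a t

  factorOf : Slot → ⊤ ⊎ (Fin α ⊎ Fin β)
  factorOf (inj₂ (inj₂ (f , _))) = inj₂ f
  factorOf _                     = inj₁ tt

  InFactor⇒slot : ∀ a b f → InFactor a b f → ∃[ s ] (atSlot a s ≡ b × factorOf s ≡ f)
  InFactor⇒slot a b (inj₁ tt) e = inj₂ (inj₁ 0F) , e , refl
  InFactor⇒slot a b (inj₂ (inj₁ i)) e =
    let t , eq = EdgeIn⇒neighbour (mfac i) e in inj₂ (inj₂ (inj₁ i , t)) , eq , refl
  InFactor⇒slot a b (inj₂ (inj₂ i)) e =
    let t , eq = EdgeIn⇒neighbour (nfac i) e in inj₂ (inj₂ (inj₂ i , t)) , eq , refl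

  -- A surjection from the v slots of a onto the v vertices is injective, so an edge that is
  -- covered at all is covered once.
  hwp : 1 + (1 + (α + β) * 2) ≡ v → (∀ a b → a ≢ b → ∃ (InFactor a b)) → HWP v M′ N′ α β
  hwp count covers = record
    { matching = matching ; mfac = mfac ; nfac = nfac
    ; decomp = λ a b a≢b → let f , e = covers a b a≢b in f , e , λ f′ e′ →
        let s  , eq  , fs  = InFactor⇒slot a b f e
            s′ , eq′ , fs′ = InFactor⇒slot a b f′ e′
        in trans (sym fs′) (trans (cong factorOf (atSlot-injective a (trans eq′ (sym eq)))) fs)
    }
    where
    atSlot-surjective : ∀ a b → ∃[ s ] atSlot a s ≡ b
    atSlot-surjective a b with a ≟ b
    ... | yes eq = inj₁ 0F , eq
    ... | no neq = let f , e = covers a b neq ; s , eq , _ = InFactor⇒slot a b f e in s , eq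
    atSlot-injective : ∀ a → Injective _≡_ _≡_ (atSlot a)
    atSlot-injective a = surjective⇒injective-↔ (subst (λ k → Fin k ↔ Slot) count slots) (atSlot-surjective a)

-- Residues of integers modulo x.

module Residues (x : ℕ) .{{_ : ℕ.NonZero x}} where

  remainder-unique : ∀ {r r′} → r < x → r′ < x → ∀ q → + r ≡ + r′ ⊕ q ⊗ + x → r ≡ r′
  remainder-unique {r} {r′} r<x r′<x (+ zero) eq = ℤ.+-injective (trans eq (ℤ.+-identityʳ (+ r′)))
  remainder-unique {r} {r′} r<x r′<x (+ suc q) eq = contradiction r<x (ℕ.≤⇒≯ x≤r)
    where
    r≡ : r ≡ r′ + suc q * x
    r≡ = ℤ.+-injective (trans eq (cong ((+ r′) ⊕_) (sym (ℤ.pos-* (suc q) x))))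
    x≤r : x ≤ r
    x≤r = subst (x ≤_) (sym r≡) (ℕ.≤-trans (ℕ.m≤m+n x (q * x)) (ℕ.m≤n+m _ r′))
  -- A negative multiplier becomes positive when the two remainders swap roles.
  remainder-unique {r} {r′} r<x r′<x -[1+ q ] eq =
    sym (remainder-unique r′<x r<x (+ suc q) (move (+ r) (+ r′) (+ suc q) (+ x) eq))
    where
    move : ∀ a b c d → a ≡ b ⊕ - c ⊗ d → b ≡ a ⊕ c ⊗ d
    move a b c d refl = cancel b c d
      where
      cancel : ∀ b c d → b ≡ b ⊕ - c ⊗ d ⊕ c ⊗ d
      cancel = solve-∀

  abstract
    π : ℤ → Fin x
    π a = fromℕ< (n%ℕd<d a x)

    toℕ-π : ∀ a → ∃[ q ] + toℕ (π a) ≡ a ⊕ q ⊗ + x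
    toℕ-π a = - (a /ℕ x) , trans (cong +_ (toℕ-fromℕ< (n%ℕd<d a x)))
      (trans (cancel (+ (a %ℕ x)) (a /ℕ x) (+ x)) (cong (_⊕ - (a /ℕ x) ⊗ + x) (sym (a≡a%ℕn+[a/ℕn]*n a x))))
      where
      cancel : ∀ r q d → r ≡ r ⊕ q ⊗ d ⊕ - q ⊗ d
      cancel = solve-∀

  π-≡ : ∀ {a b} q → a ≡ b ⊕ q ⊗ + x → π a ≡ π b
  π-≡ {a} {b} q eq = toℕ-injective (remainder-unique (toℕ<n (π a)) (toℕ<n (π b)) (qa ⊕ q - qb)
    (begin
      + toℕ (π a)                     ≡⟨ proj₂ (toℕ-π a) ⟩
      a ⊕ qa ⊗ + x                ≡⟨ cong (_⊕ qa ⊗ + x) eq ⟩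
      b ⊕ q ⊗ + x ⊕ qa ⊗ + x  ≡⟨ regroup b q qa qb (+ x) ⟩
      b ⊕ qb ⊗ + x ⊕ (qa ⊕ q - qb) ⊗ + x ≡⟨ cong (_⊕ (qa ⊕ q - qb) ⊗ + x) (proj₂ (toℕ-π b)) ⟨
      + toℕ (π b) ⊕ (qa ⊕ q - qb) ⊗ + x ∎))
    where
    open ≡-Reasoning
    qa qb : ℤ
    qa = proj₁ (toℕ-π a)
    qb = proj₁ (toℕ-π b)
    regroup : ∀ b q qa qb d → b ⊕ q ⊗ d ⊕ qa ⊗ d ≡ b ⊕ qb ⊗ d ⊕ (qa ⊕ q - qb) ⊗ d
    regroup = solve-∀

  π-toℕ : ∀ i → π (+ toℕ i) ≡ i
  π-toℕ i = let q , eq = toℕ-π (+ toℕ i) in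
    toℕ-injective (remainder-unique (toℕ<n _) (toℕ<n i) q eq)

  π-+ : ∀ a b → π (+ toℕ (π a) ⊕ b) ≡ π (a ⊕ b)
  π-+ a b = let q , eq = toℕ-π a in π-≡ q (trans (cong (_⊕ b) eq) (swap a b (q ⊗ + x)))
    where
    swap : ∀ a b c → a ⊕ c ⊕ b ≡ a ⊕ b ⊕ c
    swap = solve-∀

  offset : ∀ a i → ∃[ r ] (r < x × π (a ⊕ + r) ≡ i)
  offset a i = toℕ d , toℕ<n d , trans (cong π (ℤ.+-comm a _)) (trans (π-+ (+ toℕ i - a) a)
    (trans (cong π (cancel (+ toℕ i) a)) (π-toℕ i)))
    where
    d : Fin x
    d = π (+ toℕ i - a)
    cancel : ∀ i a → i - a ⊕ a ≡ i
    cancel = solve-∀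

  π-+-0 : ∀ i → π (+ toℕ i ⊕ + 0) ≡ i
  π-+-0 i = trans (cong π (ℤ.+-identityʳ _)) (π-toℕ i)

  not-multiple : ∀ {r} → 0 < r → r < x → ∀ q → + r ≢ q ⊗ + x
  not-multiple 0<r r<x q eq = ℕ.<⇒≢ 0<r
    (sym (remainder-unique r<x (ℕ.<-trans 0<r r<x) q (trans eq (sym (ℤ.+-identityˡ _)))))

-- Alternating sequences and parity.

alternate : (ℕ → A) → (ℕ → A) → ℕ → A
alternate f g zero          = f 0
alternate f g (suc zero)    = g 0
alternate f g (suc (suc p)) = alternate (f ∘ suc) (g ∘ suc) p

alternate-even : (f g : ℕ → A) → ∀ k → alternate f g (k * 2) ≡ f k
alternate-even f g zero    = refl
alternate-even f g (suc k) = alternate-even (f ∘ suc) (g ∘ suc) k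

alternate-odd : (f g : ℕ → A) → ∀ k → alternate f g (suc (k * 2)) ≡ g k
alternate-odd f g zero    = refl
alternate-odd f g (suc k) = alternate-odd (f ∘ suc) (g ∘ suc) k

halve : ∀ r → ∃[ e ] (r ≡ e + e ⊎ r ≡ suc (e + e))
halve zero = 0 , inj₁ refl
halve (suc r) with halve r
... | e , inj₁ refl = e , inj₂ refl
... | e , inj₂ refl = suc e , inj₁ (cong suc (sym (ℕ.+-suc e e)))

double-cancel-< : ∀ {m n} → m + m < n + n → m < n
double-cancel-< {m} {n} lt with m ℕ.<? n
... | yes m<n = m<n
... | no  m≮n = contradiction lt (ℕ.≤⇒≯ (ℕ.+-mono-≤ (ℕ.≮⇒≥ m≮n) (ℕ.≮⇒≥ m≮n)))

odd? : ℕ → Bool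
odd? zero    = false
odd? (suc k) = not (odd? k)

odd?-+ : ∀ a b → odd? (a + b) ≡ odd? a xor odd? b
odd?-+ zero    b = refl
odd?-+ (suc a) b = trans (cong not (odd?-+ a b)) (Bool.not-distribˡ-xor (odd? a) (odd? b))

odd?-double : ∀ a → odd? (a + a) ≡ false
odd?-double a = trans (odd?-+ a a) (Bool.xor-same (odd? a))

-- Z₃ and the prism on the six levels.

rot : Fin 3 → Fin 3
rot 0F = 1F
rot 1F = 2F
rot 2F = 0F

rot³ : ∀ s → rot (rot (rot s)) ≡ s
rot³ 0F = refl
rot³ 1F = refl
rot³ 2F = refl

orbit : ∀ r s → s ≡ r ⊎ (s ≡ rot r ⊎ s ≡ rot (rot r))
orbit 0F 0F = inj₁ refl
orbit 0F 1F = inj₂ (inj₁ refl)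
orbit 0F 2F = inj₂ (inj₂ refl)
orbit 1F 0F = inj₂ (inj₂ refl)
orbit 1F 1F = inj₁ refl
orbit 1F 2F = inj₂ (inj₁ refl)
orbit 2F 0F = inj₂ (inj₁ refl)
orbit 2F 1F = inj₂ (inj₂ refl)
orbit 2F 2F = inj₁ refl

Level : Set
Level = Fin 3 × Bool

-- A Hamiltonian cycle of the prism: along one triangle, across a rung, and back along the other
-- triangle.
hexagon : Fin 6 → Level
hexagon 0F = 0F , false
hexagon 1F = 1F , false
hexagon 2F = 2F , false
hexagon 3F = 2F , true
hexagon 4F = 1F , true
hexagon 5F = 0F , true

hexagon⁻¹ : Level → Fin 6
hexagon⁻¹ (0F , false) = 0F
hexagon⁻¹ (1F , false) = 1F
hexagon⁻¹ (2F , false) = 2F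
hexagon⁻¹ (2F , true)  = 3F
hexagon⁻¹ (1F , true)  = 4F
hexagon⁻¹ (0F , true)  = 5F

hexagon⁻¹-hexagon : ∀ p → hexagon⁻¹ (hexagon p) ≡ p
hexagon⁻¹-hexagon 0F = refl
hexagon⁻¹-hexagon 1F = refl
hexagon⁻¹-hexagon 2F = refl
hexagon⁻¹-hexagon 3F = refl
hexagon⁻¹-hexagon 4F = refl
hexagon⁻¹-hexagon 5F = refl

-- The three prism edges off the hexagon: the closing edge of each triangle and the middle rung.
chord : Fin 6 → Fin 6
chord 0F = 2F
chord 1F = 4F
chord 2F = 0F
chord 3F = 5F
chord 4F = 1F
chord 5F = 3F

chord-involutive : ∀ p → chord (chord p) ≡ p
chord-involutive 0F = refl
chord-involutive 1F = refl
chord-involutive 2F = refl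
chord-involutive 3F = refl
chord-involutive 4F = refl
chord-involutive 5F = refl

chord-no-fix : ∀ p → chord p ≢ p
chord-no-fix 0F ()
chord-no-fix 1F ()
chord-no-fix 2F ()
chord-no-fix 3F ()
chord-no-fix 4F ()
chord-no-fix 5F ()

-- The factors for x = 2n + 1.

module Construction (n : ℕ) (0<n : 0 < n) where

  x : ℕ
  x = suc (n + n)

  open Residues x

  Vertex : Set
  Vertex = Level × Fin x

  encode : Vertex → Fin (6 * x)
  encode (l , i) = combine (hexagon⁻¹ l) i

  decode : Fin (6 * x) → Vertex
  decode a = let p , i = remQuot x a in hexagon p , i

  encode-decode : ∀ a → encode (decode a) ≡ a
  encode-decode a = let p , i = remQuot {6} x a in
    trans (cong (λ q → combine q i) (hexagon⁻¹-hexagon p)) (combine-remQuot {6} x a)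

  hexagons : CFactor (6 * x) 5
  hexagons = cfactor x (ℕ.*-comm x 6) (λ i p → combine p i)
    λ a → let p , i = remQuot x a in (i , p) , combine-remQuot {6} x a

  hexagons-edge : ∀ p i → EdgeIn hexagons (combine p i) (combine (next p) i)
  hexagons-edge p i = i , p , inj₁ (refl , refl)

  chords : OneFactor (6 * x)
  chords = record { mate = mate ; invol = invol ; no-fix = no-fix }
    where
    mate : Fin (6 * x) → Fin (6 * x)
    mate a = let p , i = remQuot {6} x a in combine (chord p) i
    invol : ∀ a → mate (mate a) ≡ a
    invol a = let p , i = remQuot {6} x a in
      trans (cong (λ w → combine (chord (proj₁ w)) (proj₂ w)) (remQuot-combine (chord p) i))
      (trans (cong (λ q → combine q i) (chord-involutive p)) (combine-remQuot {6} x a))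
    no-fix : ∀ a → mate a ≢ a
    no-fix a eq = let p , i = remQuot {6} x a in
      chord-no-fix p (proj₁ (combine-injective (chord p) i p i (trans eq (sym (combine-remQuot {6} x a)))))

  chords-edge : ∀ p (i : Fin x) → EdgeInMatching chords (combine p i) (combine (chord p) i)
  chords-edge p i = cong (λ w → combine (chord (proj₁ w)) (proj₂ w)) (remQuot-combine {6} {x} p i)

  -- The cycle with index j is f j 0, g j 0, f j 1, g j 1, …, g j (x − 1).
  module Zigzag (f g : Fin 3 → ℕ → Vertex)
    (visits : ∀ w → ∃₂ λ j k → k < x × (f j k ≡ w ⊎ g j k ≡ w)) where

    step : Fin 3 → ℕ → Fin (6 * x)
    step j = encode ∘ alternate (f j) (g j)

    step-f : ∀ {j k w} → f j k ≡ w → step j (k * 2) ≡ encode w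
    step-f {j} {k} eq = cong encode (trans (alternate-even (f j) (g j) k) eq)

    step-g : ∀ {j k w} → g j k ≡ w → step j (suc (k * 2)) ≡ encode w
    step-g {j} {k} eq = cong encode (trans (alternate-odd (f j) (g j) k) eq)

    f-fits : ∀ {k} → k < x → k * 2 < x * 2
    f-fits k<x = ℕ.*-monoˡ-< 2 k<x

    g-fits : ∀ {k} → k < x → suc (k * 2) < x * 2
    g-fits k<x = ℕ.*-monoˡ-≤ 2 k<x

    at : ∀ {j p a} (lt : p < x * 2) → step j p ≡ a → step j (toℕ (fromℕ< lt)) ≡ a
    at {j} lt eq = trans (cong (step j) (toℕ-fromℕ< lt)) eq

    factor : CFactor (6 * x) (suc ((n + n) * 2))
    factor = cfactor 3 (thrice x) (λ j p → step j (toℕ p)) (λ a → subst Visited (encode-decode a) (visited (decode a)))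
      where
      thrice : ∀ x → 3 * (x * 2) ≡ 6 * x
      thrice = ℕSolver.solve-∀
      Visited : Fin (6 * x) → Set
      Visited a = ∃[ p ] step (proj₁ p) (toℕ {x * 2} (proj₂ p)) ≡ a
      visited : ∀ w → Visited (encode w)
      visited w with visits w
      ... | j , k , k<x , inj₁ eq = (j , fromℕ< (f-fits k<x)) , at {j} (f-fits k<x) (step-f {j} {k} eq)
      ... | j , k , k<x , inj₂ eq = (j , fromℕ< (g-fits k<x)) , at {j} (g-fits k<x) (step-g {j} {k} eq)

    step-edge : ∀ {j p a b} → suc p < x * 2 → step j p ≡ a → step j (suc p) ≡ b → EdgeIn factor a b
    step-edge {j} {p} lt eq eq′ = j , i , inj₁
      (at {j} p< eq ,
       trans (cong (step j) (trans (toℕ-next-< i (subst (λ q → suc q < x * 2) (sym i≡p) lt)) (cong suc i≡p))) eq′)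
      where
      p< : p < x * 2
      p< = ℕ.<-trans (ℕ.n<1+n p) lt
      i : Fin (x * 2)
      i = fromℕ< p<
      i≡p : toℕ i ≡ p
      i≡p = toℕ-fromℕ< p<

    fg-edge : ∀ {j w w′} k → k < x → f j k ≡ w → g j k ≡ w′ → EdgeIn factor (encode w) (encode w′)
    fg-edge {j} k k<x eq eq′ = step-edge {j} (g-fits k<x) (step-f {j} {k} eq) (step-g {j} {k} eq′)

    gf-edge : ∀ {j w w′} k → suc k < x → g j k ≡ w → f j (suc k) ≡ w′ → EdgeIn factor (encode w) (encode w′)
    gf-edge {j} k k<x eq eq′ = step-edge {j} (f-fits k<x) (step-g {j} {k} eq) (step-f {j} {suc k} eq′)

    closing-edge : ∀ {j w w′} → g j (n + n) ≡ w → f j 0 ≡ w′ → EdgeIn factor (encode w) (encode w′)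
    closing-edge {j} eq eq′ = j , i , inj₁
      (at {j} lt (step-g {j} {n + n} eq) ,
       trans (cong (step j ∘ toℕ) (next-last i (toℕ-fromℕ< lt))) (cong encode eq′))
      where
      lt : suc ((n + n) * 2) < x * 2
      lt = ℕ.n<1+n _
      i : Fin (x * 2)
      i = fromℕ< lt

  pairs : ∀ {r} → 0 < r → r < x → ∃[ m ] (r ≡ suc (toℕ {n} m + toℕ m) ⊎ r ≡ suc (suc (toℕ m + toℕ m)))
  pairs {suc r} _ (s≤s r<n+n) with halve r
  ... | e , inj₁ refl = fromℕ< e<n , inj₁ (cong (λ e → suc (e + e)) (sym (toℕ-fromℕ< e<n)))
    where
    e<n : e < n
    e<n = double-cancel-< r<n+n
  ... | e , inj₂ refl = fromℕ< e<n , inj₂ (cong (λ e → suc (suc (e + e))) (sym (toℕ-fromℕ< e<n)))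
    where
    e<n : e < n
    e<n = double-cancel-< (ℕ.<-trans (ℕ.n<1+n _) r<n+n)

  -- Two differences 2m + 1 and 2m + 2 between matched levels generate a single 2x-cycle since
  -- they differ by 1.
  module Doubled (P Q : Fin 3 → Level) (o : ℤ)
    (matched : ∀ l → ∃[ j ] (P j ≡ l ⊎ Q j ≡ l)) where

    module _ (m : Fin n) where

      -- From `f j k` to `g j k` the difference is `gap`; from `f j (suc k)` to `g j k` it is one
      -- less. Over all `m` these are the differences `o + 1` to `o + 2n`, that is, all except `o`.
      gap : ℤ
      gap = o ⊕ + suc (suc (toℕ m + toℕ m))

      f g : Fin 3 → ℕ → Vertex
      f j k = P j , π (+ k)
      g j k = Q j , π (gap ⊕ + k)

      visits : ∀ w → ∃₂ λ j k → k < x × (f j k ≡ w ⊎ g j k ≡ w)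
      visits (l , i) with matched l
      ... | j , inj₁ refl = j , toℕ i , toℕ<n i , inj₁ (cong (P j ,_) (π-toℕ i))
      ... | j , inj₂ refl = let k , k<x , eq = offset gap i in j , k , k<x , inj₂ (cong (Q j ,_) eq)

    module Z (m : Fin n) = Zigzag (f m) (g m) (visits m)
    open Z public using (factor)

    edge : ∀ j i {r} → 0 < r → r < x →
      ∃[ m ] EdgeIn (factor m) (encode (P j , i)) (encode (Q j , π (+ toℕ i ⊕ o ⊕ + r)))
    edge j i 0<r r<x with pairs 0<r r<x
    ... | m , inj₂ refl = m , Z.fg-edge m (toℕ i) (toℕ<n i) (cong (P j ,_) (π-toℕ i))
            (cong (λ a → Q j , π a) (swap o (+ toℕ i) (+ suc (suc (toℕ m + toℕ m)))))
      where
      swap : ∀ o i r → o ⊕ r ⊕ i ≡ i ⊕ o ⊕ r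
      swap = solve-∀
    ... | m , inj₁ refl = m , EdgeIn-sym (factor m) (backward (toℕ i) refl)
      where
      E : ℤ
      E = + (toℕ m + toℕ m)
      -- The difference `o + 2m + 1` occurs on edges run from the `Q` end to the `P` end. Index `k`
      -- on the `P` side is preceded by `k − 1`; for `k = 0` this is the last index `n + n`, so the
      -- edge is the closing one.
      backward : ∀ k → toℕ i ≡ k →
        EdgeIn (factor m) (encode (Q j , π (+ toℕ i ⊕ o ⊕ + suc (toℕ m + toℕ m)))) (encode (P j , i))
      backward zero eq rewrite eq =
        Z.closing-edge m (cong (Q j ,_) (π-≡ (+ 1) (wrap o E (+ (n + n)))))
          (cong (P j ,_) (trans (cong (π ∘ +_) (sym eq)) (π-toℕ i)))
        where
        wrap : ∀ o e d → o ⊕ (+ 2 ⊕ e) ⊕ d ≡ (+ 0 ⊕ o ⊕ (+ 1 ⊕ e)) ⊕ + 1 ⊗ (+ 1 ⊕ d)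
        wrap = solve-∀
      backward (suc k) eq rewrite eq =
        Z.gf-edge m k (subst (_< x) eq (toℕ<n i)) (cong (λ a → Q j , π a) (shift o E (+ k)))
          (cong (P j ,_) (trans (cong (π ∘ +_) (sym eq)) (π-toℕ i)))
        where
        shift : ∀ o e k → o ⊕ (+ 2 ⊕ e) ⊕ k ≡ (+ 1 ⊕ k) ⊕ o ⊕ (+ 1 ⊕ e)
        shift = solve-∀

  -- Halving modulo the odd number x.

  odd?-complement : ∀ {k k′} → k + k′ ≡ x → odd? k′ ≡ not (odd? k)
  odd?-complement {k} {k′} eq = xor-true (trans (sym (odd?-+ k k′)) (trans (cong odd? eq) (cong not (odd?-double n))))
    where
    xor-true : ∀ {a b} → a xor b ≡ true → b ≡ not a
    xor-true {false} {true}  _ = refl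
    xor-true {true}  {false} _ = refl

  -- 2 is invertible modulo `x`: take `r / 2` or `(r + x) / 2`, whichever is an integer.
  half : ∀ {r} → r < x → ∃[ k ] (k < x × ∃[ t ] k + k ≡ r + t * x)
  half {r} r<x with halve r
  ... | e , inj₁ refl = e , ℕ.≤-<-trans (ℕ.m≤m+n e e) r<x , 0 , sym (ℕ.+-identityʳ _)
  half {r} (s≤s r<n+n) | e , inj₂ refl = suc (e + n) , s≤s (ℕ.+-monoˡ-< n (double-cancel-< r<n+n)) , 1 , eq e n
    where
    eq : ∀ e n → suc (e + n) + suc (e + n) ≡ suc (e + e) + 1 * suc (n + n)
    eq = ℕSolver.solve-∀

  lift-≡ : ∀ {a r} t → a ≡ r + t * x → + a ≡ + r ⊕ + t ⊗ + x
  lift-≡ {a} {r} t eq = trans (cong +_ eq) (cong ((+ r) ⊕_) (ℤ.pos-* t x))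

  complement : ∀ {k} → k < x → ∃[ k′ ] k + suc k′ ≡ x
  complement {k} k<x = let k′ , eq = ℕ.m≤n⇒∃[o]m+o≡n k<x in k′ , trans (ℕ.+-suc k k′) eq

  complement-< : ∀ {k k′} → suc k + k′ ≡ x → k′ < x
  complement-< {k} {k′} eq = subst (k′ <_) eq (s≤s (ℕ.m≤n+m k′ k))

  -- If `K` is half of `r` modulo `x`, then `K` and `x − K` have opposite parities because `x` is
  -- odd, so one of them has parity `u`. Choosing `x − K` flips the sign, since
  -- `−2(x − K) = 2K − 2x`.
  half-of-parity : ∀ {r} → 0 < r → r < x → ∀ u → ∃[ k ] (suc k < x × odd? (suc k) ≡ u ×
    ∃[ t ] (+ suc k ⊕ + suc k ≡ + r ⊕ t ⊗ + x ⊎ - + suc k - + suc k ≡ + r ⊕ t ⊗ + x))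
  half-of-parity {r} 0<r r<x u with half r<x
  ... | zero  , _ , t , eq = contradiction (sym (ℕ.m+n≡0⇒m≡0 r (sym eq))) (ℕ.<⇒≢ 0<r)
  ... | suc k , k<x , t , eq with odd? (suc k) Bool.≟ u
  ...   | yes same = k , k<x , same , + t , inj₁ (lift-≡ t eq)
  ...   | no  differ = let k′ , sum = complement k<x in
          k′ , complement-< sum , trans (odd?-complement sum) (sym (Bool.¬-not (≢-sym differ))) ,
          + t - + 2 , inj₂ (reflect (+ suc k) (+ suc k′) (+ r) (+ t) (+ x) (cong +_ sum) (lift-≡ t eq))
    where
    expand : ∀ K K′ → - K′ - K′ ≡ K ⊕ K - + 2 ⊗ (K ⊕ K′)
    expand = solve-∀
    collect : ∀ R T X → R ⊕ T ⊗ X - + 2 ⊗ X ≡ R ⊕ (T - + 2) ⊗ X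
    collect = solve-∀
    reflect : ∀ K K′ R T X → K ⊕ K′ ≡ X → K ⊕ K ≡ R ⊕ T ⊗ X → - K′ - K′ ≡ R ⊕ (T - + 2) ⊗ X
    reflect K K′ R T X refl eq = trans (expand K K′) (trans (cong (_- + 2 ⊗ X) eq) (collect R T X))

  -- The first coordinate along the cycle: it drops once, on the edge from position 2 to
  -- position 3, and the closing edge makes up for the difference.
  early : ℕ → Fin 3 → Fin 3
  early zero    = rot
  early (suc _) = id

  early-surjective : ∀ k s → ∃[ j ] early k j ≡ s
  early-surjective zero    s = rot (rot s) , rot³ s
  early-surjective (suc k) s = s , refl

  -- `down j k` uses `early` at `pred k` and `up j k` at `k`, so among the edges joining them only
  -- the one at `k = 1` changes the first coordinate.
  early-pred : ∀ {k} → k ≢ 1 → ∀ j → early (ℕ.pred k) j ≡ early k j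
  early-pred {zero}          _   j = refl
  early-pred {suc zero}      k≢1 j = contradiction refl k≢1
  early-pred {suc (suc k)}   _   j = refl

  -- Shifting one of the two rows by 3 gives that exceptional edge the difference 0.
  shift : Bool → ℤ
  shift false = + 0
  shift true  = + 3

  -- The zigzag cycles with base point z.

  module _ (z : Fin x) where

    place : ℕ → Bool → Fin 3 → ℤ → Vertex
    place k u j a = (early k j , u) , π (+ toℕ z ⊕ (shift u ⊕ a))

    down up : Fin 3 → ℕ → Vertex
    down j k = place (ℕ.pred k) (odd? k) j (- + k)
    up   j k = place k (odd? (suc k)) j (+ suc k)

    visits : ∀ w → ∃₂ λ j k → k < x × (down j k ≡ w ⊎ up j k ≡ w)
    visits ((s , u) , i) with offset (+ toℕ z ⊕ shift u) i
    -- Relative to the shift of its row, residue 0 starts the cycle in row `false` and, written as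
    -- `x`, ends it in row `true`.
    visits ((s , false) , i) | zero , _ , eq = let j , j≡ = early-surjective 0 s in
      j , 0 , s≤s z≤n , inj₁ (cong₂ (λ s i → (s , false) , i) j≡ (trans (cong π (sym (ℤ.+-assoc (+ toℕ z) (+ 0) (+ 0)))) eq))
    visits ((s , true) , i) | zero , _ , eq = let j , j≡ = early-surjective (n + n) s in
      j , n + n , ℕ.n<1+n _ , inj₂ (cong₂ _,_ (cong₂ _,_ j≡ (cong not (odd?-double n)))
        (trans (π-≡ (+ 1) (trans (cong (λ u → + toℕ z ⊕ (shift (not u) ⊕ + x)) (odd?-double n)) (wrap (+ toℕ z) (+ x)))) eq))
      where
      wrap : ∀ z x → z ⊕ (+ 3 ⊕ x) ≡ (z ⊕ + 3 ⊕ + 0) ⊕ + 1 ⊗ x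
      wrap = solve-∀
    -- The residue `suc r` is a positive term in the row of its own parity. In the other row it is
    -- the negative term `−(x − suc r)`, as `x − suc r` has the opposite parity.
    visits ((s , u) , i) | suc r , r<x , eq with odd? (suc r) Bool.≟ u
    ... | yes refl = let j , j≡ = early-surjective r s in
      j , r , ℕ.<-trans (ℕ.n<1+n r) r<x , inj₂ (cong₂ (λ s i → (s , odd? (suc r)) , i) j≡
        (trans (cong π (sym (ℤ.+-assoc (+ toℕ z) (shift u) (+ suc r)))) eq))
    ... | no differ = let k , sum = complement r<x
                          j , j≡ = early-surjective k s
                          u≡ = trans (odd?-complement sum) (sym (Bool.¬-not (≢-sym differ))) in
      j , suc k , complement-< sum , inj₁ (cong₂ _,_ (cong₂ _,_ j≡ u≡)
        (trans (trans (cong (λ u → π (+ toℕ z ⊕ (shift u ⊕ - + suc k))) u≡)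
                      (π-≡ (- + 1) (wrap (+ toℕ z) (shift u) (+ suc k) (+ suc r) (+ x) (cong +_ sum)))) eq))
      where
      expand : ∀ z o k r → z ⊕ (o ⊕ - k) ≡ (z ⊕ o ⊕ r) ⊕ - + 1 ⊗ (r ⊕ k)
      expand = solve-∀
      wrap : ∀ z o k r x → r ⊕ k ≡ x → z ⊕ (o ⊕ - k) ≡ (z ⊕ o ⊕ r) ⊕ - + 1 ⊗ x
      wrap z o k r x refl = expand z o k r

  module Z (z : Fin x) = Zigzag (down z) (up z) (visits z)

  developed : Fin x → CFactor (6 * x) (suc ((n + n) * 2))
  developed = Z.factor

  -- Edges covered by the translated zigzags.

  Develops : Vertex → Vertex → Set
  Develops w w′ = ∃[ z ] EdgeIn (developed z) (encode w) (encode w′)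

  place-π : ∀ {a s i} k u {j} b → early k j ≡ s → π (a ⊕ (shift u ⊕ b)) ≡ i → place (π a) k u j b ≡ ((s , u) , i)
  place-π {a} k u b refl eq = cong (_ ,_) (trans (π-+ a (shift u ⊕ b)) eq)

  -- The step from `up j k` to `down j (suc k)` keeps both the row and the first coordinate. Its
  -- ends lie symmetrically about `a` once the base point compensates for the shift of the row.
  level-edge : ∀ s k → suc k < x → ∀ a {i i′} → π (a ⊕ + suc k) ≡ i → π (a - + suc k) ≡ i′ →
    Develops ((s , odd? (suc k)) , i) ((s , odd? (suc k)) , i′)
  level-edge s k k<x a eq eq′ = let j , j≡ = early-surjective k s in
    π (a - o) , Z.gf-edge (π (a - o)) k k<x
      (place-π k u (+ suc k) j≡ (trans (cong π (cancel a o (+ suc k))) eq))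
      (place-π k u (- + suc k) j≡ (trans (cong π (cancel a o (- + suc k))) eq′))
    where
    u : Bool
    u = odd? (suc k)
    o : ℤ
    o = shift u
    cancel : ∀ a o b → a - o ⊕ (o ⊕ b) ≡ a ⊕ b
    cancel = solve-∀

  -- Zigzag edges inside row `u` join `a + K` to `a − K` with `K` of parity `u`. So `i` is taken as
  -- `a − K` when `2K ≡ r` and as `a + K` when `−2K ≡ r`.
  within-level : ∀ s u i {r} → 0 < r → r < x →
    Develops ((s , u) , i) ((s , u) , π (+ toℕ i ⊕ + r))
  within-level s u i {r} 0<r r<x with half-of-parity 0<r r<x u
  ... | k , k<x , refl , t , inj₁ eq =
    let z , e = level-edge s k k<x (+ toℕ i ⊕ K)
                  (π-≡ t (trans (ℤ.+-assoc (+ toℕ i) K K)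
                    (trans (cong ((+ toℕ i) ⊕_) eq) (sym (ℤ.+-assoc (+ toℕ i) (+ r) (t ⊗ + x))))))
                  (trans (cong π (cancel (+ toℕ i) K)) (π-toℕ i))
    in z , EdgeIn-sym (developed z) e
    where
    K : ℤ
    K = + suc k
    cancel : ∀ i K → i ⊕ K - K ≡ i
    cancel = solve-∀
  ... | k , k<x , refl , t , inj₂ eq =
    level-edge s k k<x (+ toℕ i - K)
      (trans (cong π (cancel (+ toℕ i) K)) (π-toℕ i))
      (π-≡ t (trans (ℤ.+-assoc (+ toℕ i) (- K) (- K))
        (trans (cong ((+ toℕ i) ⊕_) eq) (sym (ℤ.+-assoc (+ toℕ i) (+ r) (t ⊗ + x))))))
    where
    K : ℤ
    K = + suc k
    cancel : ∀ i K → i - K ⊕ K ≡ i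
    cancel = solve-∀

  -- Measured from row `false` to row `true`, the step at `k` has difference `2k + 4` for even `k`
  -- and `2 − 2k` for odd `k`; the 4 is the shift 3 plus the 1 in `suc k`. A solution of
  -- `2k ≡ r − 4` serves directly if even. If odd, it is replaced by `k′ = x − 1 − k`, which is odd
  -- too and satisfies `2 − 2k′ ≡ 2k + 4`.
  between-levels : ∀ s i {r} → 0 < r → r < x →
    Develops ((s , false) , i) ((s , true) , π (+ toℕ i ⊕ + r))
  between-levels s i {r} 0<r r<x with toℕ-π (+ r - + 4)
  ... | q , r-4 with half (toℕ<n (π (+ r - + 4)))
  ... | k , k<x , t , eq = by-parity (odd? k) refl
    where
    I K R X T : ℤ
    I = + toℕ i
    K = + k
    R = + r
    X = + x
    T = q ⊕ + t
    2k : K ⊕ K ≡ R - + 4 ⊕ T ⊗ X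
    2k = trans (lift-≡ t eq) (trans (cong (_⊕ + t ⊗ X) r-4) (collect R q (+ t) X))
      where
      collect : ∀ R q t X → R - + 4 ⊕ q ⊗ X ⊕ t ⊗ X ≡ R - + 4 ⊕ (q ⊕ t) ⊗ X
      collect = solve-∀

    forward : odd? k ≡ false → Develops ((s , false) , i) ((s , true) , π (I ⊕ R))
    forward even = let j , j≡ = early-surjective k s in
      π (I ⊕ K) , Z.fg-edge (π (I ⊕ K)) k k<x
        (trans (cong (λ u → place (π (I ⊕ K)) (ℕ.pred k) u j (- K)) even)
          (place-π (ℕ.pred k) false (- K) (trans (early-pred k≢1 j) j≡) (trans (cong π (start I K)) (π-toℕ i))))
        (trans (cong (λ u → place (π (I ⊕ K)) k (not u) j (+ suc k)) even)
          (place-π k true (+ suc k) j≡ (π-≡ T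
            (trans (end I K) (trans (cong (λ a → I ⊕ a ⊕ + 4) 2k) (collect I R (T ⊗ X)))))))
      where
      k≢1 : k ≢ 1
      k≢1 refl = contradiction even λ ()
      start : ∀ I K → I ⊕ K ⊕ (+ 0 ⊕ - K) ≡ I
      start = solve-∀
      end : ∀ I K → I ⊕ K ⊕ (+ 3 ⊕ (+ 1 ⊕ K)) ≡ I ⊕ (K ⊕ K) ⊕ + 4
      end = solve-∀
      collect : ∀ I R TX → I ⊕ (R - + 4 ⊕ TX) ⊕ + 4 ≡ I ⊕ R ⊕ TX
      collect = solve-∀

    backward : odd? k ≡ true → Develops ((s , false) , i) ((s , true) , π (I ⊕ R))
    backward odd = let j , j≡ = early-surjective k′ s in
      π (I - K″) , EdgeIn-sym (developed (π (I - K″))) (Z.fg-edge (π (I - K″)) k′ k′<x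
        (trans (cong (λ u → place (π (I - K″)) (ℕ.pred k′) u j (- K′)) odd′)
          (place-π (ℕ.pred k′) true (- K′) (trans (early-pred k′≢1 j) j≡)
            (π-≡ (T - + 2) (trans (end I K K′)
              (trans (cong₂ (λ a b → I ⊕ a ⊕ + 4 - + 2 ⊗ b) 2k sum′) (collect I R T X))))))
        (trans (cong (λ u → place (π (I - K″)) k′ (not u) j K″) odd′)
          (place-π k′ false K″ j≡ (trans (cong π (start I K″)) (π-toℕ i)))))
      where
      k′ : ℕ
      k′ = proj₁ (complement k<x)
      sum : k + suc k′ ≡ x
      sum = proj₂ (complement k<x)
      K′ K″ : ℤ
      K′ = + k′
      K″ = + suc k′
      sum′ : K ⊕ (+ 1 ⊕ K′) ≡ X
      sum′ = cong +_ sum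
      k′<x : k′ < x
      k′<x = subst (k′ <_) sum (ℕ.m≤n+m (suc k′) k)
      odd′ : odd? k′ ≡ true
      odd′ = Bool.not-injective (trans (odd?-complement sum) (cong not odd))
      start : ∀ I K → I - K ⊕ (+ 0 ⊕ K) ≡ I
      start = solve-∀
      end : ∀ I K K′ → I - (+ 1 ⊕ K′) ⊕ (+ 3 ⊕ - K′) ≡ I ⊕ (K ⊕ K) ⊕ + 4 - + 2 ⊗ (K ⊕ (+ 1 ⊕ K′))
      end = solve-∀
      collect : ∀ I R T X → I ⊕ (R - + 4 ⊕ T ⊗ X) ⊕ + 4 - + 2 ⊗ X ≡ I ⊕ R ⊕ (T - + 2) ⊗ X
      collect = solve-∀
      -- `k′ = 1` is the exceptional edge: then `k + 2 = x`, so `r ≡ 2k + 4 = 2x ≡ 0`, against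
      -- `0 < r < x`.
      k′≢1 : k′ ≢ 1
      k′≢1 k′≡1 = not-multiple 0<r r<x (+ 2 - T)
        (trans (isolate R (T ⊗ X)) (trans (cong (λ a → a ⊕ + 4 - T ⊗ X) (sym 2k))
          (trans (double K (T ⊗ X))
            (trans (cong (λ a → + 2 ⊗ a - T ⊗ X) (trans (cong (λ m → K ⊕ + suc m) (sym k′≡1)) sum′)) (factor X T)))))
        where
        isolate : ∀ R TX → R ≡ R - + 4 ⊕ TX ⊕ + 4 - TX
        isolate = solve-∀
        double : ∀ K TX → K ⊕ K ⊕ + 4 - TX ≡ + 2 ⊗ (K ⊕ + 2) - TX
        double = solve-∀
        factor : ∀ X T → + 2 ⊗ X - T ⊗ X ≡ (+ 2 - T) ⊗ X
        factor = solve-∀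

    by-parity : ∀ b → odd? k ≡ b → Develops ((s , false) , i) ((s , true) , π (I ⊕ R))
    by-parity false = forward
    by-parity true  = backward

  -- The exceptional edge, at `k = 1`: relative to the base point its ends are `3 − 1` in row `true`
  -- and `2` in row `false`, while the first coordinate drops from `rot s` to `s`.
  twisted : ∀ s i → Develops ((s , false) , i) ((rot s , true) , i)
  twisted s i = π a , EdgeIn-sym (developed (π a)) (Z.fg-edge (π a) {s} 1 (s≤s (ℕ.≤-trans 0<n (ℕ.m≤m+n n n)))
      (place-π 0 true {s} (- + 1) refl (trans (cong π (cancel (+ toℕ i))) (π-toℕ i)))
      (place-π 1 false {s} (+ 2) refl (trans (cong π (cancel (+ toℕ i))) (π-toℕ i))))
    where
    a : ℤ
    a = + toℕ i - + 2
    cancel : ∀ i → i - + 2 ⊕ + 2 ≡ i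
    cancel = solve-∀

  -- The cycle ends at `3 + x ≡ 3` in row `true`, after the drop to `s`; it starts at 0 in row
  -- `false`, before the drop.
  closing : ∀ s i → Develops ((rot s , false) , i) ((s , true) , π (+ toℕ i ⊕ + 3))
  closing s i = i , EdgeIn-sym (developed i) (Z.closing-edge i {s}
      (trans (cong (λ u → place i (n + n) (not u) s (+ x)) (odd?-double n))
        (cong₂ (λ s i → (s , true) , i) (late 0<n) (π-≡ (+ 1) (wrap (+ toℕ i) (+ x)))))
      (cong ((rot s , false) ,_) (π-+-0 i)))
    where
    late : ∀ {m} → 0 < m → early (m + m) s ≡ s
    late {suc m} _ = refl
    wrap : ∀ z x → z ⊕ (+ 3 ⊕ x) ≡ z ⊕ + 3 ⊕ + 1 ⊗ x
    wrap = solve-∀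

  -- Matchings of the levels and the list of long factors.

  crossedP crossedQ : Fin 3 → Level
  crossedP j = rot j , false
  crossedQ j = j , true

  crossed-matched : ∀ l → ∃[ j ] (crossedP j ≡ l ⊎ crossedQ j ≡ l)
  crossed-matched (s , false) = rot (rot s) , inj₁ (cong (_, false) (rot³ s))
  crossed-matched (s , true)  = s , inj₂ refl

  -- Offset 3, because `closing` supplies the difference 3 for these pairs of levels.
  module Crossed = Doubled crossedP crossedQ (+ 3) crossed-matched

  -- Each matching has one pair inside each row and one twisted pair between the rows. Over the
  -- three values of `r`, every pair inside a row and every twisted pair occurs once.
  mixedP mixedQ : Fin 3 → Fin 3 → Level
  mixedP r 0F = r , false
  mixedP r 1F = rot r , true
  mixedP r 2F = rot (rot r) , false
  mixedQ r 0F = rot r , false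
  mixedQ r 1F = rot (rot r) , true
  mixedQ r 2F = r , true

  mixed-matched : ∀ r l → ∃[ j ] (mixedP r j ≡ l ⊎ mixedQ r j ≡ l)
  mixed-matched r (s , u) with orbit r s
  mixed-matched r (s , false) | inj₁ refl        = 0F , inj₁ refl
  mixed-matched r (s , false) | inj₂ (inj₁ refl) = 0F , inj₂ refl
  mixed-matched r (s , false) | inj₂ (inj₂ refl) = 2F , inj₁ refl
  mixed-matched r (s , true)  | inj₁ refl        = 2F , inj₂ refl
  mixed-matched r (s , true)  | inj₂ (inj₁ refl) = 1F , inj₁ refl
  mixed-matched r (s , true)  | inj₂ (inj₂ refl) = 1F , inj₂ refl

  -- Offset 0: the prism supplies difference 0 inside the rows, and `twisted` supplies it between
  -- them.
  module Mixed (r : Fin 3) = Doubled (mixedP r) (mixedQ r) (+ 0) (mixed-matched r)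

  doubled : Fin 4 × Fin n → CFactor (6 * x) (suc ((n + n) * 2))
  doubled (zero  , m) = Crossed.factor m
  doubled (suc r , m) = Mixed.factor r m

  longFactor : Fin x ⊎ Fin (4 * n) → CFactor (6 * x) (suc ((n + n) * 2))
  longFactor (inj₁ z) = developed z
  longFactor (inj₂ c) = doubled (remQuot n c)

  longFactors : Fin (x + 4 * n) → CFactor (6 * x) (suc ((n + n) * 2))
  longFactors = longFactor ∘ splitAt x

  -- Every edge is covered.

  record Covered (w w′ : Vertex) : Set where
    constructor covered-by
    field
      index : ⊤ ⊎ (Fin 1 ⊎ Fin (x + 4 * n))
      edge  : InFactor chords (λ _ → hexagons) longFactors (encode w) (encode w′) index

  Covered-sym : ∀ {w w′} → Covered w w′ → Covered w′ w
  Covered-sym {w} (covered-by (inj₁ tt) e) = covered-by (inj₁ tt)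
    (trans (cong (OneFactor.mate chords) (sym e)) (OneFactor.invol chords (encode w)))
  Covered-sym (covered-by (inj₂ (inj₁ i)) e) = covered-by (inj₂ (inj₁ i)) (EdgeIn-sym hexagons e)
  Covered-sym (covered-by (inj₂ (inj₂ i)) e) = covered-by (inj₂ (inj₂ i)) (EdgeIn-sym (longFactors i) e)

  by-developed : ∀ {w w′} → Develops w w′ → Covered w w′
  by-developed {w} {w′} (z , e) = covered-by (inj₂ (inj₂ (z ↑ˡ 4 * n)))
    (subst (λ c → EdgeIn (longFactor c) (encode w) (encode w′)) (sym (splitAt-↑ˡ x z (4 * n))) e)

  by-doubled : ∀ {w w′} τ → ∃[ m ] EdgeIn (doubled (τ , m)) (encode w) (encode w′) → Covered w w′
  by-doubled {w} {w′} τ (m , e) = covered-by (inj₂ (inj₂ (x ↑ʳ combine τ m)))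
    (subst (λ c → EdgeIn (longFactor c) (encode w) (encode w′)) (sym (splitAt-↑ʳ x (4 * n) (combine τ m)))
      (subst (λ c → EdgeIn (doubled c) (encode w) (encode w′)) (sym (remQuot-combine τ m)) e))

  by-hexagon : ∀ p i → Covered (hexagon p , i) (hexagon (next p) , i)
  by-hexagon p i = covered-by (inj₂ (inj₁ 0F)) (subst₂ (λ q q′ → EdgeIn hexagons (combine q i) (combine q′ i))
    (sym (hexagon⁻¹-hexagon p)) (sym (hexagon⁻¹-hexagon (next p))) (hexagons-edge p i))

  by-chord : ∀ p i → Covered (hexagon p , i) (hexagon (chord p) , i)
  by-chord p i = covered-by (inj₁ tt) (subst₂ (λ q q′ → EdgeInMatching chords (combine q i) (combine q′ i))
    (sym (hexagon⁻¹-hexagon p)) (sym (hexagon⁻¹-hexagon (chord p))) (chords-edge p i))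

  rung : ∀ s i → Covered ((s , false) , i) ((s , true) , i)
  rung 0F i = Covered-sym (by-hexagon 5F i)
  rung 1F i = by-chord 1F i
  rung 2F i = by-hexagon 2F i

  triangle : ∀ s u i → Covered ((s , u) , i) ((rot s , u) , i)
  triangle 0F false i = by-hexagon 0F i
  triangle 1F false i = by-hexagon 1F i
  triangle 2F false i = by-chord 2F i
  triangle 0F true  i = Covered-sym (by-hexagon 4F i)
  triangle 1F true  i = Covered-sym (by-hexagon 3F i)
  triangle 2F true  i = by-chord 3F i

  -- For each pair of distinct levels one difference `o` comes from a different family of edges than
  -- all the others.
  from-offsets : ∀ o {l l′} → (∀ i → Covered (l , i) (l′ , π (+ toℕ i ⊕ o))) →
    (∀ i {r} → 0 < r → r < x → Covered (l , i) (l′ , π (+ toℕ i ⊕ o ⊕ + r))) →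
    ∀ i i′ → Covered (l , i) (l′ , i′)
  from-offsets o {l} {l′} zero-offset other-offset i i′ with offset (+ toℕ i ⊕ o) i′
  ... | zero  , _   , refl =
    subst (λ i′ → Covered (l , i) (l′ , i′)) (cong π (sym (ℤ.+-identityʳ (+ toℕ i ⊕ o)))) (zero-offset i)
  ... | suc r , r<x , refl = other-offset i (s≤s z≤n) r<x

  from-offsets₀ : ∀ {l l′} → (∀ i → Covered (l , i) (l′ , i)) →
    (∀ i {r} → 0 < r → r < x → Covered (l , i) (l′ , π (+ toℕ i ⊕ + 0 ⊕ + r))) →
    ∀ i i′ → Covered (l , i) (l′ , i′)
  from-offsets₀ {l} {l′} zero-offset = from-offsets (+ 0) λ i →
    subst (λ i′ → Covered (l , i) (l′ , i′)) (sym (π-+-0 i)) (zero-offset i)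

  insert-0 : ∀ {l l′} i r → Covered (l , i) (l′ , π (+ toℕ i ⊕ + r)) → Covered (l , i) (l′ , π (+ toℕ i ⊕ + 0 ⊕ + r))
  insert-0 {l} {l′} i r = subst (λ a → Covered (l , i) (l′ , π (a ⊕ + r))) (sym (ℤ.+-identityʳ (+ toℕ i)))

  cover-within : ∀ s u i i′ → i ≢ i′ → Covered ((s , u) , i) ((s , u) , i′)
  cover-within s u i i′ i≢i′ with offset (+ toℕ i) i′
  ... | zero  , _   , eq   = contradiction (trans (sym (π-+-0 i)) eq) i≢i′
  ... | suc r , r<x , refl = by-developed (within-level s u i (s≤s z≤n) r<x)

  cover-rung : ∀ s i i′ → Covered ((s , false) , i) ((s , true) , i′)
  cover-rung s = from-offsets₀ (rung s) λ i {r} 0<r r<x → insert-0 i r (by-developed (between-levels s i 0<r r<x))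

  cover-triangle : ∀ s u i i′ → Covered ((s , u) , i) ((rot s , u) , i′)
  cover-triangle s false = from-offsets₀ (triangle s false) λ i 0<r r<x →
    by-doubled (suc s) (Mixed.edge s 0F i 0<r r<x)
  cover-triangle s true  = from-offsets₀ (triangle s true) λ i {r} 0<r r<x →
    subst (λ s → Covered ((s , true) , i) ((rot s , true) , π (+ toℕ i ⊕ + 0 ⊕ + r))) (rot³ s)
      -- The second pair of matching `r` starts at `rot r`, which is `s` for `r = rot (rot s)`.
      (by-doubled (suc (rot (rot s))) (Mixed.edge (rot (rot s)) 1F i 0<r r<x))

  cover-twisted : ∀ s i i′ → Covered ((s , false) , i) ((rot s , true) , i′)
  cover-twisted s = from-offsets₀ (λ i → by-developed (twisted s i)) λ i {r} 0<r r<x →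
    subst (λ s′ → Covered ((s′ , false) , i) ((rot s , true) , π (+ toℕ i ⊕ + 0 ⊕ + r))) (rot³ s)
      -- The third pair of matching `r` starts at `rot (rot r)`, which is `s` for `r = rot s`.
      (by-doubled (suc (rot s)) (Mixed.edge (rot s) 2F i 0<r r<x))

  cover-crossed : ∀ s i i′ → Covered ((rot s , false) , i) ((s , true) , i′)
  cover-crossed s = from-offsets (+ 3) (λ i → by-developed (closing s i)) λ i 0<r r<x →
    by-doubled 0F (Crossed.edge s i 0<r r<x)

  covered : ∀ w w′ → w ≢ w′ → Covered w w′
  covered ((s , u) , i) ((s′ , u′) , i′) neq with orbit s s′
  covered ((s , false) , i) ((_ , false) , i′) neq | inj₁ refl = cover-within s false i i′ (neq ∘ cong (_ ,_))
  covered ((s , true)  , i) ((_ , true)  , i′) neq | inj₁ refl = cover-within s true i i′ (neq ∘ cong (_ ,_))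
  covered ((s , false) , i) ((_ , true)  , i′) neq | inj₁ refl = cover-rung s i i′
  covered ((s , true)  , i) ((_ , false) , i′) neq | inj₁ refl = Covered-sym (cover-rung s i′ i)
  covered ((s , false) , i) ((_ , false) , i′) neq | inj₂ (inj₁ refl) = cover-triangle s false i i′
  covered ((s , true)  , i) ((_ , true)  , i′) neq | inj₂ (inj₁ refl) = cover-triangle s true i i′
  covered ((s , false) , i) ((_ , true)  , i′) neq | inj₂ (inj₁ refl) = cover-twisted s i i′
  covered ((s , true)  , i) ((_ , false) , i′) neq | inj₂ (inj₁ refl) = Covered-sym (cover-crossed s i′ i)
  -- From `s′ = rot (rot s)` follows `s = rot s′`, so the preceding cases recur with the two ends
  -- exchanged.
  covered ((s , u) , i) ((s′ , u′) , i′) neq | inj₂ (inj₂ eq) with trans (cong rot eq) (rot³ s)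
  covered ((_ , false) , i) ((s′ , false) , i′) neq | inj₂ (inj₂ eq) | refl = Covered-sym (cover-triangle s′ false i′ i)
  covered ((_ , true)  , i) ((s′ , true)  , i′) neq | inj₂ (inj₂ eq) | refl = Covered-sym (cover-triangle s′ true i′ i)
  covered ((_ , false) , i) ((s′ , true)  , i′) neq | inj₂ (inj₂ eq) | refl = cover-crossed s′ i i′
  covered ((_ , true)  , i) ((s′ , false) , i′) neq | inj₂ (inj₂ eq) | refl = Covered-sym (cover-twisted s′ i′ i)

  solution : HWP (6 * x) 5 (suc ((n + n) * 2)) 1 (x + 4 * n)
  solution = hwp chords (λ _ → hexagons) longFactors (count n) λ a b a≢b →
    let covered-by f e = covered (decode a) (decode b)
                           λ eq → a≢b (trans (sym (encode-decode a)) (trans (cong encode eq) (encode-decode b)))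
    in f , subst₂ (λ a b → InFactor chords (λ _ → hexagons) longFactors a b f) (encode-decode a) (encode-decode b) e
    where
    -- A vertex, its mate and two neighbours in each of the `1 + x + 4n` cycle factors make `6x` in
    -- all.
    count : ∀ n → 1 + (1 + (1 + (suc (n + n) + 4 * n)) * 2) ≡ 6 * suc (n + n)
    count = ℕSolver.solve-∀

-- From residues modulo 6 to x = 2n + 1.

hwp-odd : ∀ n x → x ≥ 5 → x ≡ suc (n + n) → HWPSolution (6 * x) 6 (2 * x) 1 (3 * x ∸ 2)
hwp-odd zero    x (s≤s ()) refl
hwp-odd (suc n) x x≥5 refl =
  subst₂ (λ N′ β → HWP (6 * x) 5 N′ 1 β) (cong (_∸ 1) (length (suc n))) (cong (_∸ 2) (number (suc n)))
    (Construction.solution (suc n) (s≤s z≤n))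
  where
  length : ∀ n → suc (suc ((n + n) * 2)) ≡ 2 * suc (n + n)
  length = ℕSolver.solve-∀
  number : ∀ n → 2 + (suc (n + n) + 4 * n) ≡ 3 * suc (n + n)
  number = ℕSolver.solve-∀

theorem8 : (x : ℕ) → x ≥ 5 → (x % 6 ≡ 1 ⊎ x % 6 ≡ 5) →
    HWPSolution (6 * x) 6 (2 * x) 1 (3 * x ∸ 2)
theorem8 x x≥5 residue = odd residue
  where
  q : ℕ
  q = x ℕ./ 6
  x≡ : ∀ {r} → x % 6 ≡ r → x ≡ r + q * 6
  x≡ eq = trans (m≡m%n+[m/n]*n x 6) (cong (_+ q * 6) eq)
  one : ∀ q → 1 + q * 6 ≡ suc (3 * q + 3 * q)
  one = ℕSolver.solve-∀
  five : ∀ q → 5 + q * 6 ≡ suc ((2 + 3 * q) + (2 + 3 * q))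
  five = ℕSolver.solve-∀
  odd : x % 6 ≡ 1 ⊎ x % 6 ≡ 5 → HWPSolution (6 * x) 6 (2 * x) 1 (3 * x ∸ 2)
  odd (inj₁ eq) = hwp-odd (3 * q) x x≥5 (trans (x≡ eq) (one q))
  odd (inj₂ eq) = hwp-odd (2 + 3 * q) x x≥5 (trans (x≡ eq) (five q))
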